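{- There exists an infeasible instance of size $23$.
   Context: Fix a palette of six distinct colors. A (colored) cube is a unit cube each of whose six faces is painted with exactly one color of the palette, all six faces receiving different colors. Two colored cubes have the same variety if one can be rotated onto the other; there are exactly 30 varieties. An instance is a finite multiset of colored cubes (several cubes of the same variety are allowed); its size is the number of cubes counted with multiplicity. A solid is a $2\times2\times2$ cube assembled from eight colored unit cubes such that each of its six outer $2\times2$ faces is of a single color and the six outer faces have six different colors; its variety is defined as for unit cubes. A solid of variety $v$ is composable from an instance $I$ if some eight cubes of $I$ can be placed and oriented to form a solid of variety $v$. An instance is infeasible if no solid of any variety is composable from it. -}

module Defs where

open import Data.Bool using (Bool; true; false; not)
open import Data.Fin using (Fin; zero; suc)
open import Data.List using (List; length; lookup)
open import Data.Product using (Σ; ∃; _×_; _,_; proj₁)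
open import Data.Nat using (ℕ)
open import Function.Definitions using (Injective)
open import Relation.Binary.PropositionalEquality using (_≡_)
open import Relation.Nullary using (¬_)

Colour : Set
Colour = Fin 6

-- Coordinate axes x, y, z are 0, 1, 2.
Axis : Set
Axis = Fin 3

-- A face of a (unit or 2×2×2) cube: an axis and a side
-- (true = positive side, false = negative side).
Face : Set
Face = Axis × Bool

-- Rotations of the cube: the group generated by the quarter turns about
-- the three coordinate axes (this is the full proper rotation group of the cube).
data Rot : Set where
  idR : Rot
  qx  : Rot   -- y ↦ z , z ↦ -y
  qy  : Rot   -- z ↦ x , x ↦ -z
  qz  : Rot   -- x ↦ y , y ↦ -x
  _∘R_ : Rot → Rot → Rot

act : Rot → Face → Face
act idR f = f
act qx (zero , b) = (zero , b)
act qx (suc zero , b) = (suc (suc zero) , b)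
act qx (suc (suc zero) , b) = (suc zero , not b)
act qy (suc (suc zero) , b) = (zero , b)
act qy (zero , b) = (suc (suc zero) , not b)
act qy (suc zero , b) = (suc zero , b)
act qz (zero , b) = (suc zero , b)
act qz (suc zero , b) = (zero , not b)
act qz (suc (suc zero) , b) = (suc (suc zero) , b)
act (r ∘R s) f = act r (act s f)

Colouring : Set
Colouring = Face → Colour

Cube : Set
Cube = Σ Colouring (Injective _≡_ _≡_)

colour : Cube → Colouring
colour = proj₁

RotatedBy : Rot → Colouring → Colouring → Set
RotatedBy r c₁ c₂ = ∀ f → c₂ (act r f) ≡ c₁ f

SameVariety : Colouring → Colouring → Set
SameVariety c₁ c₂ = ∃ λ r → RotatedBy r c₁ c₂

-- An instance: a finite multiset of coloured cubes (a list; order is irrelevant).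
Instance : Set
Instance = List Cube

size : Instance → ℕ
size = length

-- The eight positions in a 2×2×2 cube (coordinate true = positive half).
Pos : Set
Pos = Bool × Bool × Bool

coord : Pos → Axis → Bool
coord (x , y , z) zero = x
coord (x , y , z) (suc zero) = y
coord (x , y , z) (suc (suc zero)) = z

-- An assembly of a solid from eight distinct cubes of the instance I.
-- The cube I[pick p] is placed at position p, rotated by orient p.
-- Its face f then lies at act (orient p) f = (a , b); it is on the outer
-- face (a , b) of the solid exactly when coord p a ≡ b, and must then carry
-- the colour of that outer face.  The six outer faces have distinct colours.
record Solid (I : Instance) : Set where
  field
    pick      : Pos → Fin (length I)
    pick-inj  : Injective _≡_ _≡_ pick
    orient    : Pos → Rot
    solidCol  : Colouring
    solid-inj : Injective _≡_ _≡_ solidCol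
    fit       : ∀ p f → let af = act (orient p) f in
                coord p (proj₁ af) ≡ Data.Product.proj₂ af →
                colour (lookup I (pick p)) f ≡ solidCol af

Composable : Instance → Cube → Set
Composable I v = Σ (Solid I) λ s → SameVariety (Solid.solidCol s) (colour v)

Infeasible : Instance → Set
Infeasible I = ∀ v → ¬ Composable I v

{-# OPTIONS --safe #-}
module Submission where

-- A cube fits a position of a solid iff it shows the cyclically ordered triple
-- of outer colours there at one of its own corners.  The 40 such triples are
-- partitioned by the corners of five varieties; take 1, 1, 7, 7, 7 cubes of
-- these.  A solid of one of the five varieties needs 8 cubes of that variety.
-- Any other solid needs exactly 2 cubes from each of four of the five
-- varieties, hence from at least one of those with a single cube.

open import Defs
open import Data.Bool using (true; false; if_then_else_; _xor_)
import Data.Bool.Properties as Bool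
open import Data.Fin using (Fin; zero; suc; cast)
open import Data.Fin.Patterns using (0F; 1F; 2F; 3F; 4F; 5F)
import Data.Fin.Properties as Fin
open import Data.List using (List; []; _∷_; length; lookup; map; concatMap; filter; replicate; allFin; cartesianProduct)
open import Data.List.Membership.Propositional using (_∈_)
open import Data.List.Membership.Propositional.Properties using (∈-map⁺; ∈-map⁻; ∈-filter⁺; ∈-filter⁻; ∈-allFin; ∈-lookup)
open import Data.List.Membership.Setoid.Properties using (index-injective)
open import Data.List.Properties using (length-map)
open import Data.List.Relation.Binary.Subset.Propositional using (_⊆_)
import Data.List.Relation.Unary.All as All
import Data.List.Relation.Unary.AllPairs as ListPairs
open import Data.List.Relation.Unary.Any using (index)
open import Data.List.Relation.Unary.Unique.Propositional renaming (Unique to UniqueList)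
import Data.List.Relation.Unary.Unique.Propositional.Properties as UniqueList
import Data.List.Relation.Unary.Unique.DecPropositional as DecUniqueList
import Data.List.Membership.DecPropositional as DecMembership
open import Data.Nat using (ℕ; zero; suc; _<_; _≤_; _<?_)
import Data.Nat.Properties as ℕ
open import Data.Product using (Σ; ∃-syntax; _×_; _,_; proj₁; proj₂)
open import Data.Product.Properties using (≡-dec)
open import Data.Vec using (Vec; []; _∷_; tabulate) renaming (lookup to lookupᵥ)
open import Data.Vec.Properties using (lookup∘tabulate)
import Data.Vec.Relation.Unary.All as AllVec
import Data.Vec.Relation.Unary.AllPairs as VecPairs
open import Data.Vec.Relation.Unary.Unique.Propositional using (Unique)
import Data.Vec.Relation.Unary.Unique.Propositional.Properties as Unique
open import Function using (_∘_)
open import Function.Definitions using (Injective)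
open import Relation.Binary.Definitions using (DecidableEquality)
open import Relation.Binary.PropositionalEquality
open import Relation.Nullary using (Dec; ¬_)
open import Relation.Nullary.Decidable using (from-yes; map′; _→-dec_; ¬?)
open import Relation.Nullary.Negation using (contradiction)
open import Relation.Unary using (Decidable)

-- Lists without repetition and search over permutations

lookup-map : ∀ {A B : Set} (f : A → B) xs (i : Fin (length (map f xs))) →
             lookup (map f xs) i ≡ f (lookup xs (cast (length-map f xs) i))
lookup-map f (x ∷ xs) zero    = refl
lookup-map f (x ∷ xs) (suc i) = lookup-map f xs i

lookup-unique-injective : ∀ {A : Set} {xs : List A} → UniqueList xs → Injective _≡_ _≡_ (lookup xs)
lookup-unique-injective (_ ListPairs.∷ _)  {zero}  {zero}  _ = refl
lookup-unique-injective (x∉ ListPairs.∷ _) {zero}  {suc j} e =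
  contradiction e (All.lookup x∉ (∈-lookup j))
lookup-unique-injective (x∉ ListPairs.∷ _) {suc i} {zero}  e =
  contradiction (sym e) (All.lookup x∉ (∈-lookup i))
lookup-unique-injective (_ ListPairs.∷ u)  {suc i} {suc j} e = cong suc (lookup-unique-injective u e)

-- Pigeonhole: otherwise two entries of `xs` would share an index in `ys`.
unique-⊆⇒length≤ : ∀ {A : Set} {xs ys : List A} → UniqueList xs → xs ⊆ ys → length xs ≤ length ys
unique-⊆⇒length≤ {A} {xs} {ys} u xs⊆ys = ℕ.≮⇒≥ λ shorter →
  let i , j , i<j , e = Fin.pigeonhole shorter (index ∘ member)
  in Fin.<⇒≢ i<j (lookup-unique-injective u (index-injective (setoid A) (member i) (member j) e))
  where
  member : ∀ i → lookup xs i ∈ ys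
  member i = xs⊆ys (∈-lookup i)

-- Distinctness is moved into the hypothesis of the decided predicate, one head at a time, so a
-- vector with a repetition passes without a test of `P`.
allUnique? : ∀ {k} n {P : Vec (Fin k) n → Set} → Decidable P → Dec (∀ v → Unique v → P v)
allUnique? zero    P? = map′ (λ { p [] _ → p }) (λ h → h [] VecPairs.[]) (P? [])
allUnique? (suc n) P? =
  map′ (λ { h (a ∷ v) (a∉v VecPairs.∷ u) → h a v u a∉v }) (λ h a v u a∉v → h (a ∷ v) (a∉v VecPairs.∷ u))
       (Fin.all? λ a → allUnique? n λ v →
          AllVec.all? (λ b → ¬? (a Fin.≟ b)) v →-dec P? (a ∷ v))

-- Faces and paintings

face : Fin 6 → Face
face 0F = 0F , true
face 1F = 0F , false
face 2F = 1F , true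
face 3F = 1F , false
face 4F = 2F , true
face 5F = 2F , false

faceIndex : Face → Fin 6
faceIndex (0F , true)  = 0F
faceIndex (0F , false) = 1F
faceIndex (1F , true)  = 2F
faceIndex (1F , false) = 3F
faceIndex (2F , true)  = 4F
faceIndex (2F , false) = 5F

face-faceIndex : ∀ f → face (faceIndex f) ≡ f
face-faceIndex (0F , false) = refl
face-faceIndex (0F , true)  = refl
face-faceIndex (1F , false) = refl
face-faceIndex (1F , true)  = refl
face-faceIndex (2F , false) = refl
face-faceIndex (2F , true)  = refl

faceIndex-injective : Injective _≡_ _≡_ faceIndex
faceIndex-injective {f} {g} e =
  trans (sym (face-faceIndex f)) (trans (cong face e) (face-faceIndex g))

face-injective : Injective _≡_ _≡_ face
face-injective {i} {j} = from-yes (Fin.all? λ i → Fin.all? λ j → (face i ≟ᶠ face j) →-dec (i Fin.≟ j)) i j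
  where
  _≟ᶠ_ : DecidableEquality Face
  _≟ᶠ_ = ≡-dec Fin._≟_ Bool._≟_

-- The entries are the colours of +x, -x, +y, -y, +z, -z.
Painting : Set
Painting = Vec Colour 6

colouring : Painting → Colouring
colouring v = lookupᵥ v ∘ faceIndex

-- Replacing a function by a vector turns a claim about all solids into a finite search.
painting : Colouring → Painting
painting c = tabulate (c ∘ face)

colouring-painting : ∀ c f → colouring (painting c) f ≡ c f
colouring-painting c f = trans (lookup∘tabulate (c ∘ face) (faceIndex f)) (cong c (face-faceIndex f))

painting-unique : ∀ {c} → Injective _≡_ _≡_ c → Unique (painting c)
painting-unique inj = Unique.tabulate⁺ (face-injective ∘ inj)

paintedCube : (v : Painting) → Unique v → Cube
paintedCube v u = colouring v , faceIndex-injective ∘ Unique.lookup-injective u _ _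

-- Corners and rotations

Triple : Set → Set
Triple A = A × A × A

mapTriple : ∀ {A B : Set} → (A → B) → Triple A → Triple B
mapTriple f (a , b , c) = f a , f b , f c

triple-≟ : ∀ {A : Set} → DecidableEquality A → DecidableEquality (Triple A)
triple-≟ _≟_ = ≡-dec _≟_ (≡-dec _≟_ _≟_)

-- The outer faces at a position, listed with the same sense of rotation at every position.
outerFaces : Pos → Triple Face
outerFaces (x , y , z) =
  -- Changing one side reflects the corner and reverses the sense, so the parity of the number of
  -- positive sides decides the order.
  if x xor (y xor z) then (0F , x) , (1F , y) , (2F , z)
                     else (0F , x) , (2F , z) , (1F , y)

positions : List Pos
positions = cartesianProduct bools (cartesianProduct bools bools)
  where bools = true ∷ false ∷ []

positions-unique : UniqueList positions
positions-unique = from-yes (unique? positions)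
  where open DecUniqueList (≡-dec Bool._≟_ (≡-dec Bool._≟_ Bool._≟_))

-- A rotation may carry `outerFaces p` to a cyclic shift of another such triple. Including all three
-- shifts gives closure under rotations and makes comparison up to cyclic order plain membership.
corners : List (Triple Face)
corners = concatMap (λ p → let (f , g , h) = outerFaces p in
                       (f , g , h) ∷ (g , h , f) ∷ (h , f , g) ∷ []) positions

_∈corners? : Decidable (_∈ corners)
t ∈corners? = t ∈? corners
  where open DecMembership (triple-≟ (≡-dec Fin._≟_ Bool._≟_))

outerFaces-corner : ∀ {p} → p ∈ positions → outerFaces p ∈ corners
outerFaces-corner = All.lookup (from-yes (All.all? (λ p → outerFaces p ∈corners?) positions))

-- The three quarter turns are checked on all 24 triples; composites follow by induction.
act-corner : ∀ r {t} → t ∈ corners → mapTriple (act r) t ∈ corners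
act-corner idR      m = m
act-corner qx       = All.lookup (from-yes (All.all? (λ t → mapTriple (act qx) t ∈corners?) corners))
act-corner qy       = All.lookup (from-yes (All.all? (λ t → mapTriple (act qy) t ∈corners?) corners))
act-corner qz       = All.lookup (from-yes (All.all? (λ t → mapTriple (act qz) t ∈corners?) corners))
act-corner (r ∘R s) m = act-corner r (act-corner s m)

-- A quarter turn has order four, so its third power inverts it.
inverse : Rot → Rot
inverse idR      = idR
inverse qx       = qx ∘R (qx ∘R qx)
inverse qy       = qy ∘R (qy ∘R qy)
inverse qz       = qz ∘R (qz ∘R qz)
inverse (r ∘R s) = inverse s ∘R inverse r

act-inverse : ∀ r f → act r (act (inverse r) f) ≡ f
act-inverse idR f = refl
act-inverse qx (0F , _)     = refl
act-inverse qx (1F , false) = refl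
act-inverse qx (1F , true)  = refl
act-inverse qx (2F , false) = refl
act-inverse qx (2F , true)  = refl
act-inverse qy (0F , false) = refl
act-inverse qy (0F , true)  = refl
act-inverse qy (1F , _)     = refl
act-inverse qy (2F , false) = refl
act-inverse qy (2F , true)  = refl
act-inverse qz (0F , false) = refl
act-inverse qz (0F , true)  = refl
act-inverse qz (1F , false) = refl
act-inverse qz (1F , true)  = refl
act-inverse qz (2F , _)     = refl
act-inverse (r ∘R s) f =
  trans (cong (act r) (act-inverse s (act (inverse r) f))) (act-inverse r f)

-- The five varieties and the demand of a solid

colouredCorners : Painting → List (Triple Colour)
colouredCorners v = map (mapTriple (colouring v)) corners

outerColours : Painting → Pos → Triple Colour
outerColours v = mapTriple (colouring v) ∘ outerFaces

listed? : ∀ v ts → Decidable λ p → outerColours v p ∈ ts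
listed? v ts p = outerColours v p ∈? ts
  where open DecMembership (triple-≟ Fin._≟_)

-- The pairs of opposite colours form a one-factorization of the complete graph on six colours: any
-- two colours are opposite in exactly one variety. So any three colours meet at a corner in exactly
-- two varieties, and the paintings are chosen so that they do so in opposite senses.
variety : Fin 5 → Painting
variety 0F = 0F ∷ 2F ∷ 1F ∷ 3F ∷ 4F ∷ 5F ∷ []
variety 1F = 0F ∷ 3F ∷ 1F ∷ 5F ∷ 2F ∷ 4F ∷ []
variety 2F = 0F ∷ 1F ∷ 2F ∷ 5F ∷ 4F ∷ 3F ∷ []
variety 3F = 0F ∷ 4F ∷ 1F ∷ 2F ∷ 5F ∷ 3F ∷ []
variety 4F = 0F ∷ 5F ∷ 1F ∷ 4F ∷ 3F ∷ 2F ∷ []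

variety-unique : ∀ k → Unique (variety k)
variety-unique = from-yes (Fin.all? λ k → VecPairs.allPairs? (λ a b → ¬? (a Fin.≟ b)) (variety k))

copies : Fin 5 → ℕ
copies 0F = 1
copies 1F = 1
copies 2F = 7
copies 3F = 7
copies 4F = 7

-- Because of this, the outer colours at a position determine which variety must supply its cube.
varieties-disjoint : ∀ j k {t} → t ∈ colouredCorners (variety j) → t ∈ colouredCorners (variety k) → j ≡ k
varieties-disjoint j k = All.lookup
  (from-yes (Fin.all? λ j → Fin.all? λ k →
     All.all? (λ t → (t ∈? colouredCorners (variety k)) →-dec (j Fin.≟ k)) (colouredCorners (variety j))) j k)
  where open DecMembership (triple-≟ Fin._≟_)

-- Abstract, because unification would otherwise evaluate these searches on open terms.
abstract
  positionsOf : Painting → Fin 5 → List Pos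
  positionsOf v k = filter (listed? v (colouredCorners (variety k))) positions

  ∈-positionsOf⁻ : ∀ v k {p} → p ∈ positionsOf v k →
                   p ∈ positions × outerColours v p ∈ colouredCorners (variety k)
  ∈-positionsOf⁻ v k = ∈-filter⁻ (listed? v (colouredCorners (variety k))) {xs = positions}

  positionsOf-unique : ∀ v k → UniqueList (positionsOf v k)
  positionsOf-unique v k = UniqueList.filter⁺ (listed? v (colouredCorners (variety k))) positions-unique

  -- Exhaustive search over the 720 permutations. The witness is either the solid's own variety,
  -- needed 8 times, or a variety with a single copy, needed twice.
  shortage : ∀ v → Unique v → ∃[ k ] copies k < length (positionsOf v k)
  shortage = from-yes (allUnique? 6 λ v → Fin.any? λ k → copies k <? length (positionsOf v k))

-- The instance

kindCube : Fin 5 → Cube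
kindCube k = paintedCube (variety k) (variety-unique k)

-- For a variable `ks` the two lengths agree only propositionally, hence the `cast`.
kind : ∀ ks → Fin (length (map kindCube ks)) → Fin 5
kind ks i = lookup ks (cast (length-map kindCube ks) i)

kinds : List (Fin 5)
kinds = concatMap (λ k → replicate (copies k) k) (allFin 5)

abstract
  ofKind : ∀ ks → Fin 5 → List (Fin (length (map kindCube ks)))
  ofKind ks k = filter (λ i → kind ks i Fin.≟ k) (allFin _)

  ∈-ofKind⁺ : ∀ ks {i k} → kind ks i ≡ k → i ∈ ofKind ks k
  ∈-ofKind⁺ ks {i} {k} = ∈-filter⁺ (λ i → kind ks i Fin.≟ k) (∈-allFin i)

  length-ofKind : ∀ k → length (ofKind kinds k) ≡ copies k
  length-ofKind = from-yes (Fin.all? λ k → length (ofKind kinds k) ℕ.≟ copies k)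

-- Supply bounds the demand of a solid

module _ ks (s : Solid (map kindCube ks)) where
  open Solid s

  private
    v : Painting
    v = painting solidCol

  -- `fit` starts from a face of the unplaced cube, so it is applied to the face that `orient p`
  -- carries to the outer face.
  fit-inverse : ∀ p {a} → let r = orient p; f = (a , coord p a) in
                colouring (variety (kind ks (pick p))) (act (inverse r) f) ≡ colouring v f
  fit-inverse p {a} = begin
    colouring (variety (kind ks (pick p))) g     ≡⟨ cong (λ c → colour c g) (lookup-map kindCube ks (pick p)) ⟨
    colour (lookup (map kindCube ks) (pick p)) g ≡⟨ fit p g outer ⟩
    solidCol (act r g)                           ≡⟨ cong solidCol (act-inverse r f) ⟩
    solidCol f                                   ≡⟨ colouring-painting solidCol f ⟨
    colouring v f                                ∎
    where
    open ≡-Reasoning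
    r = orient p
    f = (a , coord p a)
    g = act (inverse r) f
    outer : coord p (proj₁ (act r g)) ≡ proj₂ (act r g)
    outer = subst (λ h → coord p (proj₁ h) ≡ proj₂ h) (sym (act-inverse r f)) refl

  outerColours-pulledBack : ∀ p → outerColours v p ≡
    mapTriple (colouring (variety (kind ks (pick p)))) (mapTriple (act (inverse (orient p))) (outerFaces p))
  -- The split lets `outerFaces p` reduce to a triple; both orders contain the same three faces.
  outerColours-pulledBack p@(x , y , z) with x xor (y xor z)
  ... | true  = sym (cong₂ _,_ (fit-inverse p) (cong₂ _,_ (fit-inverse p) (fit-inverse p)))
  ... | false = sym (cong₂ _,_ (fit-inverse p) (cong₂ _,_ (fit-inverse p) (fit-inverse p)))

  outerColours-supplied : ∀ {p} → p ∈ positions →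
                          outerColours v p ∈ colouredCorners (variety (kind ks (pick p)))
  outerColours-supplied {p} p∈ = subst (_∈ colouredCorners w) (sym (outerColours-pulledBack p))
    (∈-map⁺ (mapTriple (colouring w)) (act-corner (inverse (orient p)) (outerFaces-corner p∈)))
    where w = variety (kind ks (pick p))

  -- The same triple is a corner of the picked cube's variety and of `variety k`, so disjointness
  -- identifies the two.
  pick-ofKind : ∀ {k p} → p ∈ positionsOf v k → pick p ∈ ofKind ks k
  pick-ofKind {k} {p} p∈ =
    let p∈positions , listed = ∈-positionsOf⁻ v k p∈
    in ∈-ofKind⁺ ks (varieties-disjoint (kind ks (pick p)) k {outerColours v p}
         (outerColours-supplied p∈positions) listed)

  picks⊆ofKind : ∀ k → map pick (positionsOf v k) ⊆ ofKind ks k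
  picks⊆ofKind k i∈ =
    let p , p∈ , i≡ = ∈-map⁻ pick {xs = positionsOf v k} i∈
    in subst (_∈ ofKind ks k) (sym i≡) (pick-ofKind p∈)

  -- `pick` sends these positions injectively to cubes of kind `k`.
  positionsOf-bound : ∀ k → length (positionsOf v k) ≤ length (ofKind ks k)
  positionsOf-bound k = begin
    length (positionsOf v k)            ≡⟨ length-map pick (positionsOf v k) ⟨
    length (map pick (positionsOf v k)) ≤⟨ unique-⊆⇒length≤ unique-picks (picks⊆ofKind k) ⟩
    length (ofKind ks k)                ∎
    where
    open ℕ.≤-Reasoning
    unique-picks : UniqueList (map pick (positionsOf v k))
    unique-picks = UniqueList.map⁺ pick-inj (positionsOf-unique v k)

noSolid : ¬ Solid (map kindCube kinds)
noSolid s with k , short ← shortage (painting (Solid.solidCol s)) (painting-unique (Solid.solid-inj s)) =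
  ℕ.<⇒≱ short (subst (length (positionsOf _ k) ≤_) (length-ofKind k) (positionsOf-bound kinds s k))

theorem2 : Σ Instance (λ I → size I ≡ 23 × Infeasible I)
theorem2 = map kindCube kinds , refl , λ _ (s , _) → noSolid s
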